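{- For every integer $k \ge 3$ there exists $N$ such that for all $n \ge N$ we have $g_k(n) \le h_k(n) < 4 n^{1 - \frac{1}{2^{k-2}}}$.
   Context: For positive integers $n$ and $k \ge 3$, $g_k(n)$ denotes the smallest integer such that for every set $A \subseteq \{1, 2, \ldots, 2n\}$ with $|A| \ge n + g_k(n)$ there exist pairwise distinct integers $b_1, \ldots, b_k$ (arbitrary integers, not required to be positive or to lie in $A$) with $b_i + b_j \in A$ for all $1 \le i < j \le k$. Likewise $h_k(n)$ denotes the smallest integer such that for every set $A \subseteq \{1, 2, \ldots, 2n\}$ with $|A| \ge n + h_k(n)$ there exist $k$ pairwise distinct positive integers $b_1, \ldots, b_k$ with $b_i + b_j \in A$ for all $1 \le i < j \le k$. -}

module Defs where

open import Data.Nat as ℕ using (ℕ; _^_; _∸_)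
open import Data.Integer as ℤ using (ℤ; +_; _+_; _≤_; _<_; +<+)
open import Data.Fin using (Fin; toℕ)
open import Data.Fin.Subset using (Subset; _∈_; ∣_∣)
open import Data.Product using (Σ; ∃; _×_)
open import Data.Sum using (_⊎_)
open import Function.Definitions using (Injective)
open import Relation.Binary.PropositionalEquality using (_≡_; _≢_)

-- A subset of {1,…,2n}: index i : Fin (2n) stands for the integer i+1.
SetIn : ℕ → Set
SetIn n = Subset (2 ℕ.* n)

InA : (n : ℕ) → ℤ → SetIn n → Set
InA n x A = Σ (Fin (2 ℕ.* n)) λ i → (i ∈ A) × (x ≡ + (ℕ.suc (toℕ i)))

PairSumsIn : (n k : ℕ) → (Fin k → ℤ) → SetIn n → Set
PairSumsIn n k b A = (i j : Fin k) → i ≢ j → InA n (b i + b j) A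

HasSumsetZ : (k n : ℕ) → SetIn n → Set
HasSumsetZ k n A = Σ (Fin k → ℤ) λ b → Injective _≡_ _≡_ b × PairSumsIn n k b A

HasSumsetPos : (k n : ℕ) → SetIn n → Set
HasSumsetPos k n A =
  Σ (Fin k → ℤ) λ b → Injective _≡_ _≡_ b × ((i : Fin k) → + 0 < b i) × PairSumsIn n k b A

Admissible : (n : ℕ) → (SetIn n → Set) → ℤ → Set
Admissible n P t = (A : SetIn n) → + n + t ≤ + (∣_∣ {2 ℕ.* n} A) → P A

IsLeast : (ℤ → Set) → ℤ → Set
IsLeast Q t = Q t × ((s : ℤ) → Q s → t ≤ s)

Is-g : ℕ → ℕ → ℤ → Set
Is-g k n = IsLeast (Admissible n (HasSumsetZ k n))

Is-h : ℕ → ℕ → ℤ → Set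
Is-h k n = IsLeast (Admissible n (HasSumsetPos k n))

-- h < 4 n^(1 - 1/m)  (m ≥ 1), stated without reals:
-- either h ≤ 0 (then it holds trivially), or h = +t with t^m < 4^m n^(m-1).
BelowBound : ℤ → ℕ → ℕ → Set
BelowBound h n m = (h ≤ + 0) ⊎ (Σ ℕ λ t → (h ≡ + t) × (t ^ m ℕ.< 4 ^ m ℕ.* n ^ (m ∸ 1)))

{-# OPTIONS --safe #-}

-- A set A ⊆ {1, …, 2n} with |A| ≥ n + s contains at least s even numbers 2 (x + 1); let E be the set of these x < n.
-- By counting pairs some difference d outside a given short list satisfies |E ∩ (E - d)| ≳ |E|² / 2n.
-- Iterating k - 1 times yields x and distinct c₁ = 0, c₂, …, c_k with x + cᵢ + cⱼ ∈ E for i ≠ j, provided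
-- |E| ≥ C n^(1 - 1/2^(k-2)); then bᵢ = x + 1 + 2 cᵢ are positive and bᵢ + bⱼ = 2 (x + cᵢ + cⱼ + 1) ∈ A.
-- The least values g and h exist constructively because three pairwise sums bound their summands, so that
-- the existence of b₁, …, b_k is decided by a finite search.
module Submission where

open import Defs
open import Data.Bool using (Bool; true; false; T; _∧_; if_then_else_)
open import Data.Bool.Properties using (T-∧)
open import Data.Fin as Fin using (Fin; zero; suc; toℕ)
import Data.Fin.Properties as Finₚ
open import Data.Fin.Subset as Subset using (∣_∣; ⊥)
open import Data.Fin.Subset.Properties using (_∈?_; anySubset?; ∉⊥; ∣p∣≤n)
open import Data.Integer as ℤ using (ℤ; +_; -[1+_]; -_; +<+; +≤+)
import Data.Integer.Properties as ℤₚ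
import Data.Integer.Tactic.RingSolver as ℤ-Solver
open import Data.List using (List; []; _∷_; length; lookup; map; upTo; _++_)
open import Data.List.Membership.Propositional using (_∈_; find; lose)
open import Data.List.Membership.Propositional.Properties using (∈-lookup; ∈-++⁺ˡ; ∈-++⁺ʳ; ∈-map⁺; ∈-upTo⁺)
open import Data.List.Relation.Unary.All as All using (All; []; _∷_)
open import Data.List.Relation.Unary.AllPairs using (AllPairs; []; _∷_)
open import Data.List.Relation.Unary.Any using (Any; any?)
open import Data.List.Relation.Unary.Unique.Propositional using (Unique)
open import Data.Nat
open import Data.Nat.Properties
open import Algebra.Properties.CommutativeSemigroup +-commutativeSemigroup using (interchange; x∙yz≈y∙xz)
open import Data.Nat.Tactic.RingSolver using (solve-∀)
open import Data.Product using (Σ; ∃; _×_; _,_; proj₁; proj₂)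
open import Data.Sum using (inj₁; inj₂)
open import Data.Vec using ([]; _∷_; here; there)
import Data.Vec.Functional as Vector
open import Function using (_∘_; Equivalence)
open import Function.Definitions using (Injective)
open import Level using (0ℓ)
open import Relation.Binary using (Rel; Symmetric)
open import Relation.Binary.PropositionalEquality
open import Relation.Nullary using (¬_; Dec; yes; no; contradiction; ¬?; _×-dec_; _→-dec_)
open import Relation.Nullary.Decidable using (map′; decidable-stable)

-- Finite sums and counting

∑ : ℕ → (ℕ → ℕ) → ℕ
∑ zero    g = 0
∑ (suc n) g = g 0 + ∑ n (g ∘ suc)

∑-mono : ∀ n {g h} → (∀ d → g d ≤ h d) → ∑ n g ≤ ∑ n h
∑-mono zero    g≤h = z≤n
∑-mono (suc n) g≤h = +-mono-≤ (g≤h 0) (∑-mono n (g≤h ∘ suc))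

∑-extend : ∀ {m n} g → m ≤ n → ∑ m g ≤ ∑ n g
∑-extend g z≤n       = z≤n
∑-extend g (s≤s m≤n) = +-monoʳ-≤ (g 0) (∑-extend (g ∘ suc) m≤n)

∑-+ : ∀ n g h → ∑ n (λ d → g d + h d) ≡ ∑ n g + ∑ n h
∑-+ zero    g h = refl
∑-+ (suc n) g h rewrite ∑-+ n (g ∘ suc) (h ∘ suc) = interchange (g 0) (h 0) _ _

∑-* : ∀ n w g → ∑ n (λ d → w * g d) ≡ w * ∑ n g
∑-* zero    w g = sym (*-zeroʳ w)
∑-* (suc n) w g rewrite ∑-* n w (g ∘ suc) = sym (*-distribˡ-+ w (g 0) _)

𝟙 : Bool → ℕ
𝟙 false = 0
𝟙 true  = 1

𝟙≤1 : ∀ b → 𝟙 b ≤ 1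
𝟙≤1 false = z≤n
𝟙≤1 true  = ≤-refl

𝟙-∧ : ∀ a b → 𝟙 (a ∧ b) ≡ 𝟙 a * 𝟙 b
𝟙-∧ false b = refl
𝟙-∧ true  b = sym (+-identityʳ (𝟙 b))

# : ℕ → (ℕ → Bool) → ℕ
# n f = ∑ n (𝟙 ∘ f)

-- Intersections with shifts and popular differences

infixl 7 _⊓ₛ_
_⊓ₛ_ : (ℕ → Bool) → ℕ → (ℕ → Bool)
(f ⊓ₛ d) x = f x ∧ f (x + d)

#-⊓ₛ : ∀ n f d → # n (f ⊓ₛ d) ≤ # n f
#-⊓ₛ n f d = ∑-mono n λ x → le (f x) (f (x + d))
  where
  le : ∀ a b → 𝟙 (a ∧ b) ≤ 𝟙 a
  le false b = z≤n
  le true  b = 𝟙≤1 b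

#-nonempty : ∀ n f → 0 < # n f → ∃ λ x → T (f x)
#-nonempty (suc n) f 0<# with f 0 in eq
... | true  = 0 , subst T (sym eq) _
... | false with #-nonempty n (f ∘ suc) 0<#
...   | x , fx = suc x , fx

-- Each pair x ≤ y of the set is counted at the difference d = y - x, including d = 0.
∑-#-⊓ₛ : ∀ {n D} f → n ≤ D → # n f * suc (# n f) ≤ 2 * ∑ D (λ d → # n (f ⊓ₛ d))
∑-#-⊓ₛ {zero}      f n≤D = z≤n
∑-#-⊓ₛ {suc n} {D} f n<D = begin
  -- Position 0 is split off. If it belongs to the set, `t * suc t` exceeds `t′ * suc t′` by exactly
  -- `2 * t`, and 0 is the smaller element of `# D f` counted pairs. `D` stays fixed while `n`
  -- shrinks, hence the hypothesis `n ≤ D`.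
  t * suc t                                        ≤⟨ expand (f 0) ⟩
  2 * (𝟙 (f 0) * t) + t′ * suc t′                  ≤⟨ +-mono-≤ (*-monoʳ-≤ 2 (*-monoʳ-≤ (𝟙 (f 0)) (∑-extend (𝟙 ∘ f) n<D)))
                                                               (∑-#-⊓ₛ (f ∘ suc) (<⇒≤ n<D)) ⟩
  2 * (𝟙 (f 0) * # D f) + 2 * S′                   ≡⟨ *-distribˡ-+ 2 (𝟙 (f 0) * # D f) S′ ⟨
  2 * (𝟙 (f 0) * # D f + S′)                       ≡⟨ cong (λ s → 2 * (s + S′)) (∑-* D (𝟙 (f 0)) (𝟙 ∘ f)) ⟨
  2 * (∑ D (λ d → 𝟙 (f 0) * 𝟙 (f d)) + S′)         ≤⟨ *-monoʳ-≤ 2 (+-monoˡ-≤ S′ (∑-mono D λ d → ≤-reflexive (sym (𝟙-∧ (f 0) (f d))))) ⟩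
  2 * (∑ D (λ d → 𝟙 (f 0 ∧ f d)) + S′)             ≡⟨ cong (2 *_) (∑-+ D (λ d → 𝟙 (f 0 ∧ f d)) (λ d → # n ((f ∘ suc) ⊓ₛ d))) ⟨
  2 * ∑ D (λ d → # (suc n) (f ⊓ₛ d))               ∎
  where
  open ≤-Reasoning
  t = # (suc n) f
  t′ = # n (f ∘ suc)
  S′ = ∑ D (λ d → # n ((f ∘ suc) ⊓ₛ d))
  square : ∀ t → (1 + t) * (2 + t) ≡ 2 * (1 * (1 + t)) + t * suc t
  square = solve-∀
  expand : ∀ b → (𝟙 b + t′) * suc (𝟙 b + t′) ≤ 2 * (𝟙 b * (𝟙 b + t′)) + t′ * suc t′
  expand false = ≤-refl
  expand true  = ≤-reflexive (square t′)

erase : ℕ → (ℕ → ℕ) → (ℕ → ℕ)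
erase e g d = if d ≡ᵇ e then 0 else g d

∑-erase : ∀ n e g {B} → (∀ d → g d ≤ B) → ∑ n g ≤ B + ∑ n (erase e g)
∑-erase zero    e       g     g≤B = z≤n
∑-erase (suc n) zero    g     g≤B = +-monoˡ-≤ _ (g≤B 0)
∑-erase (suc n) (suc e) g {B} g≤B = begin
  g 0 + ∑ n (g ∘ suc)                     ≤⟨ +-monoʳ-≤ (g 0) (∑-erase n e (g ∘ suc) (g≤B ∘ suc)) ⟩
  g 0 + (B + ∑ n (erase e (g ∘ suc)))     ≡⟨ x∙yz≈y∙xz (g 0) B _ ⟩
  B + (g 0 + ∑ n (erase e (g ∘ suc)))     ∎
  where open ≤-Reasoning

erase-≤ : ∀ e g d → erase e g d ≤ g d
erase-≤ e g d with d ≡ᵇ e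
... | true  = z≤n
... | false = ≤-refl

erase-≢ : ∀ e g d {X} → X < erase e g d → d ≢ e
erase-≢ e g d X<gd d≡e with d ≡ᵇ e in eq
... | true  = n≮0 X<gd
... | false = subst T eq (≡⇒≡ᵇ d e d≡e)

∑-large⇒∃-large : ∀ n X g → n * X < ∑ n g → ∃ λ d → X < g d
∑-large⇒∃-large (suc n) X g lt with X <? g 0
... | yes X<g0 = 0 , X<g0
... | no  X≮g0 with ∑-large⇒∃-large n X (g ∘ suc)
                      (+-cancelˡ-< X _ _ (<-≤-trans lt (+-monoˡ-≤ _ (≮⇒≥ X≮g0))))
...   | d , X<gd = suc d , X<gd

-- Setting the value at a forbidden index to 0 costs the sum at most `B`, so after all of `F` more
-- than `n * X` remains and some value exceeds the average. An erased value cannot exceed `X`, so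
-- the index found avoids `F`.
pigeonhole-avoiding : ∀ n X F g {B} → (∀ d → g d ≤ B) →
  n * X + length F * B < ∑ n g → ∃ λ d → All (d ≢_) F × X < g d
pigeonhole-avoiding n X []      g     g≤B lt
  with ∑-large⇒∃-large n X g (subst (_< ∑ n g) (+-identityʳ (n * X)) lt)
... | d , X<gd = d , [] , X<gd
pigeonhole-avoiding n X (e ∷ F) g {B} g≤B lt
  with pigeonhole-avoiding n X F (erase e g) (λ d → ≤-trans (erase-≤ e g d) (g≤B d))
         (+-cancelˡ-< B _ _ (<-≤-trans (subst (_< ∑ n g) (x∙yz≈y∙xz (n * X) B (length F * B)) lt)
                                       (∑-erase n e g g≤B)))
... | d , d∉F , X<g′d =
  d , erase-≢ e g d X<g′d ∷ d∉F , <-≤-trans X<g′d (erase-≤ e g d)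

-- The slack T ≤ |f| + 1 absorbs that a non-admissible h - 1 only provides h - 1 even elements;
-- the factor 3 instead of 2 absorbs the terms linear in |f|.
popular-difference : ∀ n F f {T} .{{_ : NonZero n}} → T ≤ suc (# n f) → 6 * length F + 4 ≤ T →
  ∃ λ d → All (d ≢_) F × T * T < 3 * n * # n (f ⊓ₛ d)
popular-difference n F f {T} T≤ ≤T =
  pigeonhole-avoiding n (T * T) F (λ d → 3 * n * # n (f ⊓ₛ d))
    (λ d → *-monoʳ-≤ (3 * n) (#-⊓ₛ n f d))
    (subst₂ _<_ (left n (T * T) j t) (trans (right n S) (sym (∑-* n (3 * n) (λ d → # n (f ⊓ₛ d)))))
      (*-monoʳ-< n (*-cancelˡ-< 2 _ _ enough)))
  where
  open ≤-Reasoning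
  j = length F
  t = # n f
  S = ∑ n (λ d → # n (f ⊓ₛ d))
  left : ∀ n X j t → n * (X + 3 * (j * t)) ≡ n * X + j * (3 * n * t)
  left = solve-∀
  right : ∀ n S → n * (3 * S) ≡ 3 * n * S
  right = solve-∀
  -- In terms of `u` the gap in `large` is a polynomial in `j` and `u` with nonnegative
  -- coefficients, displayed in `poly`.
  u = t ∸ (6 * j + 3)
  t≡ : 6 * j + 3 + u ≡ t
  t≡ = m+[n∸m]≡n (≤-pred (≤-trans (≤-reflexive (sym (+-suc (6 * j) 3))) (≤-trans ≤T T≤)))
  poly : ∀ j u → suc (2 * (suc (6 * j + 3 + u) * suc (6 * j + 3 + u) + 3 * (j * (6 * j + 3 + u))))
                 + (12 * j + 6 * j * u + 3 + 5 * u + u * u)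
               ≡ 3 * ((6 * j + 3 + u) * suc (6 * j + 3 + u))
  poly = solve-∀
  three : ∀ S → 3 * (2 * S) ≡ 2 * (3 * S)
  three = solve-∀
  large : 2 * (suc t * suc t + 3 * (j * t)) < 3 * (t * suc t)
  large = subst (λ t → 2 * (suc t * suc t + 3 * (j * t)) < 3 * (t * suc t)) t≡
            (≤-trans (m≤m+n _ _) (≤-reflexive (poly j u)))
  enough : 2 * (T * T + 3 * (j * t)) < 2 * (3 * S)
  enough = begin-strict
    2 * (T * T + 3 * (j * t))          ≤⟨ *-monoʳ-≤ 2 (+-monoˡ-≤ _ (*-mono-≤ T≤ T≤)) ⟩
    2 * (suc t * suc t + 3 * (j * t))  <⟨ large ⟩
    3 * (t * suc t)                    ≤⟨ *-monoʳ-≤ 3 (∑-#-⊓ₛ {n} f ≤-refl) ⟩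
    3 * (2 * S)                        ≡⟨ three S ⟩
    2 * (3 * S)                        ∎

-- The last difference needs a single surviving base point, so averaging with `X = 0` suffices. It
-- does not square the density: of the k - 1 differences only k - 2 do, whence the exponent 2^(k-2).
new-difference : ∀ n F f → 0 < # n f → 2 * length F < suc (# n f) →
  ∃ λ d → All (d ≢_) F × 0 < # n (f ⊓ₛ d)
new-difference n F f 0<t 2j<1+t =
  pigeonhole-avoiding n 0 F (λ d → # n (f ⊓ₛ d)) (#-⊓ₛ n f)
    (subst (_< S) (cong (_+ j * t) (sym (*-zeroʳ n))) (*-cancelˡ-< 2 _ _ enough))
  where
  open ≤-Reasoning
  j = length F
  t = # n f
  S = ∑ n (λ d → # n (f ⊓ₛ d))
  instance
    t≢0 : NonZero t
    t≢0 = >-nonZero 0<t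
  enough : 2 * (j * t) < 2 * S
  enough = begin-strict
    2 * (j * t)  ≡⟨ *-assoc 2 j t ⟨
    2 * j * t    <⟨ *-monoˡ-< t 2j<1+t ⟩
    suc t * t    ≡⟨ *-comm (suc t) t ⟩
    t * suc t    ≤⟨ ∑-#-⊓ₛ {n} f ≤-refl ⟩
    2 * S        ∎

-- Iterating the choice of differences

PairSums : (ℕ → Bool) → ℕ → List ℕ → Set
PairSums f x = AllPairs (λ c d → T (f (x + c + d)))

-- The invariant of the iteration: g marks base points x of the configuration F.
record Bases (f : ℕ → Bool) (F : List ℕ) (g : ℕ → Bool) : Set where
  field
    self  : ∀ x → T (g x) → T (f x)
    sums  : ∀ x → T (g x) → All (λ c → T (f (x + c))) F
    pairs : ∀ x → T (g x) → PairSums f x F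

-- A new base `x` has both `x` and `x + d` among the old bases. The facts `self` and `sums` at
-- `x + d` become the sum with `d` and the pair sums of `d` with `F` at `x`.
extend : ∀ {f F g} d → Bases f F g → Bases f (d ∷ F) (g ⊓ₛ d)
extend {g = g} d B = record
  { self  = λ x p → self x (π₁ x p)
  ; sums  = λ x p → self (x + d) (π₂ x p) ∷ sums x (π₁ x p)
  ; pairs = λ x p → sums (x + d) (π₂ x p) ∷ pairs x (π₁ x p)
  }
  where
  open Bases B
  π₁ : ∀ x → T ((g ⊓ₛ d) x) → T (g x)
  π₁ x p = proj₁ (Equivalence.to (T-∧ {g x}) p)
  π₂ : ∀ x → T ((g ⊓ₛ d) x) → T (g (x + d))
  π₂ x p = proj₂ (Equivalence.to (T-∧ {g x}) p)

2^1+r : ∀ m r → m ^ (2 ^ suc r) ≡ (m * m) ^ (2 ^ r)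
2^1+r m r = begin
  m ^ (2 * 2 ^ r)            ≡⟨ ^-*-assoc m 2 (2 ^ r) ⟨
  (m ^ 2) ^ (2 ^ r)          ≡⟨ cong (λ s → (m * s) ^ (2 ^ r)) (*-identityʳ m) ⟩
  (m * m) ^ (2 ^ r)          ∎
  where open ≡-Reasoning

^-distribʳ-* : ∀ a b e → (a * b) ^ e ≡ a ^ e * b ^ e
^-distribʳ-* a b zero    = refl
^-distribʳ-* a b (suc e) rewrite ^-distribʳ-* a b e = swap a b (a ^ e) (b ^ e)
  where
  swap : ∀ a b c d → a * b * (c * d) ≡ a * c * (b * d)
  swap = solve-∀

-- Writing u = T / N, the hypothesis says K / N ≤ u ^ 2 ^ r, and passing to a popular difference replaces u by at least u².
density-step : ∀ r {K N T T′} .{{_ : NonZero N}} → T * T < N * T′ →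
  K * N ^ (2 ^ suc r) ≤ N * T ^ (2 ^ suc r) → K * N ^ (2 ^ r) ≤ N * T′ ^ (2 ^ r)
density-step r {K} {N} {T} {T′} T²<NT′ dense = *-cancelʳ-≤ _ _ (N ^ e) {{m^n≢0 N e}} (begin
  K * N ^ e * N ^ e          ≡⟨ *-assoc K (N ^ e) (N ^ e) ⟩
  K * (N ^ e * N ^ e)        ≡⟨ cong (K *_) (^-distribʳ-* N N e) ⟨
  K * (N * N) ^ e            ≡⟨ cong (K *_) (2^1+r N r) ⟨
  K * N ^ (2 ^ suc r)        ≤⟨ dense ⟩
  N * T ^ (2 ^ suc r)        ≡⟨ cong (N *_) (2^1+r T r) ⟩
  N * (T * T) ^ e            ≤⟨ *-monoʳ-≤ N (^-monoˡ-≤ e (<⇒≤ T²<NT′)) ⟩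
  N * (N * T′) ^ e           ≡⟨ cong (N *_) (^-distribʳ-* N T′ e) ⟩
  N * (N ^ e * T′ ^ e)       ≡⟨ rotate N (N ^ e) (T′ ^ e) ⟩
  N * T′ ^ e * N ^ e         ∎)
  where
  open ≤-Reasoning
  e = 2 ^ r
  rotate : ∀ a b c → a * (b * c) ≡ a * c * b
  rotate = solve-∀

-- If `T < L`, then `T ^ (2 ^ suc r) ≤ N`, so density would give `K * N ^ (2 ^ suc r) ≤ N * N`,
-- which is impossible for `K ≥ 2`. This supplies the lower bound on `T` that `popular-difference`
-- requires.
dense⇒large : ∀ r {K N T L} .{{_ : NonZero N}} → 2 ≤ K → L ^ (2 ^ suc r) ≤ N →
  K * N ^ (2 ^ suc r) ≤ N * T ^ (2 ^ suc r) → L ≤ T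
dense⇒large r {K} {N} {T} {L} 2≤K L^≤N dense with L ≤? T
... | yes L≤T = L≤T
... | no  L≰T = contradiction (begin-strict
  N ^ (2 ^ suc r)            <⟨ m<m*n (N ^ (2 ^ suc r)) K {{m^n≢0 N (2 ^ suc r)}} 2≤K ⟩
  N ^ (2 ^ suc r) * K        ≡⟨ *-comm (N ^ (2 ^ suc r)) K ⟩
  K * N ^ (2 ^ suc r)        ≤⟨ dense ⟩
  N * T ^ (2 ^ suc r)        ≤⟨ *-monoʳ-≤ N (^-monoˡ-≤ (2 ^ suc r) (≰⇒≥ L≰T)) ⟩
  N * L ^ (2 ^ suc r)        ≤⟨ *-monoʳ-≤ N L^≤N ⟩
  N * N                      ≡⟨ cong (N *_) (*-identityʳ N) ⟨
  N ^ 2                      ≤⟨ ^-monoʳ-≤ N (*-monoʳ-≤ 2 (m^n>0 2 r)) ⟩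
  N ^ (2 ^ suc r)            ∎) (<-irrefl refl)
  where open ≤-Reasoning

-- There are `r` popular differences and then one from `new-difference`. The quantity `length F + r`
-- is constant along the recursion, so one `K` and one `L` serve all steps. At `r = 0` density reads
-- `K * N ≤ N * T`, which leaves more bases than the forbidden differences can use up.
iterate-differences : ∀ r {n N K L T f F g} .{{_ : NonZero n}} .{{_ : NonZero N}} → N ≡ 3 * n →
  Unique F → 0 < length F → Bases f F g →
  2 * (length F + r) < K →
  6 * (length F + r) + 4 ≤ L →
  L ^ (2 ^ r) ≤ N →
  T ≤ suc (# n g) →
  K * N ^ (2 ^ r) ≤ N * T ^ (2 ^ r) →
  ∃ λ G → length G ≡ suc (length F + r) × Unique G × ∃ λ x → PairSums f x G
iterate-differences zero {n} {N} {K} {L} {T} {f} {F} {g} N≡3n uF 0<j bF 2j<K _ _ T≤ dense =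
  let d , d∉F , 0<# = new-difference n F g 0<t 2j<1+t
      x , gx        = #-nonempty n (g ⊓ₛ d) 0<#
  in d ∷ F , cong suc (sym (+-identityʳ (length F))) , d∉F ∷ uF , x , Bases.pairs (extend d bF) x gx
  where
  K≤T : K ≤ T
  K≤T = *-cancelˡ-≤ N (subst₂ _≤_ (trans (cong (K *_) (*-identityʳ N)) (*-comm K N))
                                  (cong (N *_) (*-identityʳ T)) dense)
  2j<1+t : 2 * length F < suc (# n g)
  2j<1+t = <-≤-trans (subst (λ j → 2 * j < K) (+-identityʳ (length F)) 2j<K) (≤-trans K≤T T≤)
  0<t : 0 < # n g
  0<t = ≤-pred (≤-trans (s≤s (≤-trans 0<j (m≤m+n (length F) _))) 2j<1+t)
iterate-differences (suc r) {n} {N} {K} {L} {T} {f} {F} {g} N≡3n uF 0<j bF 2j<K j≤L L≤ T≤ dense =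
  let d , d∉F , T²<     = popular-difference n F g T≤ (≤-trans 6j+4≤L (dense⇒large r 2≤K L≤ dense))
      G , lenG , result = iterate-differences r N≡3n (d∉F ∷ uF) (s≤s z≤n) (extend d bF)
                            (subst (λ j → 2 * j < K) j+1+r 2j<K)
                            (subst (λ j → 6 * j + 4 ≤ L) j+1+r j≤L)
                            (≤-trans (^-monoʳ-≤ L {{L≢0}} (m≤m+n (2 ^ r) _)) L≤)
                            -- The new `T` is the exact count `# n (g ⊓ₛ d)`, one below what the
                            -- hypothesis allows.
                            (n≤1+n _)
                            (density-step r {K = K} (subst (λ m → T * T < m * # n (g ⊓ₛ d)) (sym N≡3n) T²<) dense)
  in G , trans lenG (cong suc (sym j+1+r)) , result
  where
  j+1+r : length F + suc r ≡ suc (length F + r)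
  j+1+r = +-suc (length F) r
  2≤K : 2 ≤ K
  2≤K = ≤-trans (s≤s (≤-trans 0<j (≤-trans (m≤m+n (length F) (suc r)) (m≤m+n (length F + suc r) _)))) 2j<K
  6j+4≤L : 6 * length F + 4 ≤ L
  6j+4≤L = ≤-trans (+-monoˡ-≤ 4 (*-monoʳ-≤ 6 (m≤m+n (length F) (suc r)))) j≤L
  L≢0 : NonZero L
  L≢0 = >-nonZero (≤-trans (m≤n+m 1 _) (≤-trans (+-monoʳ-≤ _ (s≤s (z≤n {3}))) j≤L))

-- Even elements of A and the resulting summands

lookup-AllPairs : ∀ {A : Set} {R : Rel A 0ℓ} {xs} → Symmetric R → AllPairs R xs →
  ∀ i j → i ≢ j → R (lookup xs i) (lookup xs j)
lookup-AllPairs R-sym (_  ∷ _)  zero    zero    i≢j = contradiction refl i≢j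
lookup-AllPairs R-sym (rs ∷ _)  zero    (suc j) i≢j = All.lookup rs (∈-lookup j)
lookup-AllPairs R-sym (rs ∷ _)  (suc i) zero    i≢j = R-sym (All.lookup rs (∈-lookup i))
lookup-AllPairs R-sym (_  ∷ ps) (suc i) (suc j) i≢j = lookup-AllPairs R-sym ps i j (i≢j ∘ cong suc)

-- The value `false` beyond the end means that a true value already certifies that the position is
-- in range.
at : ∀ {m} → Subset.Subset m → ℕ → Bool
at []      _       = false
at (s ∷ p) zero    = s
at (s ∷ p) (suc x) = at p x

∣∣≡# : ∀ {m} (p : Subset.Subset m) → ∣ p ∣ ≡ # m (at p)
∣∣≡# []          = refl
∣∣≡# (true ∷ p)  = cong suc (∣∣≡# p)
∣∣≡# (false ∷ p) = ∣∣≡# p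

at⇒∈ : ∀ {m} (p : Subset.Subset m) x → T (at p x) → ∃ λ i → i Subset.∈ p × toℕ i ≡ x
at⇒∈ (true ∷ p) zero    _  = zero , here , refl
at⇒∈ (_    ∷ p) (suc x) px with at⇒∈ p x px
... | i , i∈p , eq = suc i , there i∈p , cong suc eq

-- Each of the `n` even positions, which hold the odd integers, contributes at most 1.
∑-2* : ∀ n g → (∀ x → g x ≤ 1) → ∑ (2 * n) g ≤ n + ∑ n (λ x → g (suc (2 * x)))
∑-2* zero    g g≤1 = z≤n
∑-2* (suc n) g g≤1 rewrite +-suc n (n + 0) = +-mono-≤ (g≤1 0) (begin
  g 1 + ∑ (2 * n) (λ x → g (2 + x))         ≤⟨ +-monoʳ-≤ (g 1) (∑-2* n (λ x → g (2 + x)) (λ x → g≤1 (2 + x))) ⟩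
  g 1 + (n + ∑ n (λ x → g (3 + 2 * x)))     ≡⟨ x∙yz≈y∙xz (g 1) n _ ⟩
  n + (g 1 + ∑ n (λ x → g (3 + 2 * x)))     ≤⟨ +-monoʳ-≤ n (+-monoʳ-≤ (g 1) (∑-mono n λ x → ≤-reflexive (cong (λ y → g (1 + y)) (sym (*-suc 2 x))))) ⟩
  n + (g 1 + ∑ n (λ x → g (1 + 2 * suc x)))   ∎)
  where open ≤-Reasoning

-- Position 2x + 1 of A holds the even integer 2x + 2 = 2 (x + 1).
evens : ∀ {m} → Subset.Subset m → ℕ → Bool
evens A x = at A (suc (2 * x))

∣∣≤n+#evens : ∀ n (A : SetIn n) → ∣ A ∣ ≤ n + # n (evens A)
∣∣≤n+#evens n A = ≤-trans (≤-reflexive (∣∣≡# A)) (∑-2* n (𝟙 ∘ at A) (𝟙≤1 ∘ at A))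

pairSums⇒sumset : ∀ n (A : SetIn n) x G → Unique G → PairSums (evens A) x G → HasSumsetPos (length G) n A
pairSums⇒sumset n A x G uG pG = b , b-injective , (λ i → +<+ z<s) , b-sums
  where
  b : Fin (length G) → ℤ
  b i = + (suc x + 2 * lookup G i)
  b-injective : ∀ {i j} → b i ≡ b j → i ≡ j
  b-injective {i} {j} eq with i Fin.≟ j
  ... | yes i≡j = i≡j
  ... | no  i≢j = contradiction
    (*-cancelˡ-≡ _ _ 2 (+-cancelˡ-≡ (suc x) _ _ (ℤₚ.+-injective eq)))
    (lookup-AllPairs (_∘ sym) uG i j i≢j)
  sum-of : ∀ x c d → suc (suc (2 * (x + c + d))) ≡ suc x + 2 * c + (suc x + 2 * d)
  sum-of = solve-∀
  swap : ∀ x c d → x + c + d ≡ x + d + c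
  swap = solve-∀
  b-sums : ∀ i j → i ≢ j → InA n (b i ℤ.+ b j) A
  b-sums i j i≢j =
    let l , l∈A , eq = at⇒∈ A _ (lookup-AllPairs (λ {c} {d} → subst (T ∘ evens A) (swap x c d)) pG i j i≢j)
    in l , l∈A , cong +_ (sym (trans (cong suc eq) (sum-of x (lookup G i) (lookup G j))))

-- The quantitative bound for large n

-- With k = 3 + i, the constant 5 + 2i = 2k - 1 is the value of K that iterate-differences needs in the last step.
[5+2i]3^m≤3*4^m : ∀ i → (5 + 2 * i) * 3 ^ (2 ^ suc i) ≤ 3 * 4 ^ (2 ^ suc i)
[5+2i]3^m≤3*4^m zero    = m≤m+n 45 3
[5+2i]3^m≤3*4^m (suc i) = *-cancelˡ-≤ 3 (begin
  3 * ((5 + 2 * suc i) * 3 ^ (2 ^ suc (suc i)))    ≡⟨ cong (λ s → 3 * ((5 + 2 * suc i) * s)) (square 3) ⟩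
  -- Squaring the induction hypothesis suffices because `(5 + 2 * i)²` exceeds `3 * (7 + 2 * i)` by
  -- `4 + 14 * i + 4 * i * i`.
  3 * ((5 + 2 * suc i) * (a * a))                  ≤⟨ m≤m+n _ ((4 + 14 * i + 4 * i * i) * (a * a)) ⟩
  3 * ((5 + 2 * suc i) * (a * a)) + (4 + 14 * i + 4 * i * i) * (a * a)  ≡⟨ poly i a ⟩
  (5 + 2 * i) * a * ((5 + 2 * i) * a)              ≤⟨ *-mono-≤ ([5+2i]3^m≤3*4^m i) ([5+2i]3^m≤3*4^m i) ⟩
  3 * b * (3 * b)                                  ≡⟨ nine b ⟩
  3 * (3 * (b * b))                                ≡⟨ cong (λ s → 3 * (3 * s)) (square 4) ⟨
  3 * (3 * 4 ^ (2 ^ suc (suc i)))                  ∎)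
  where
  open ≤-Reasoning
  a = 3 ^ (2 ^ suc i)
  b = 4 ^ (2 ^ suc i)
  square : ∀ m → m ^ (2 ^ suc (suc i)) ≡ m ^ (2 ^ suc i) * m ^ (2 ^ suc i)
  square m = trans (2^1+r m (suc i)) (^-distribʳ-* m m (2 ^ suc i))
  poly : ∀ i a → 3 * ((5 + 2 * suc i) * (a * a)) + (4 + 14 * i + 4 * i * i) * (a * a) ≡ (5 + 2 * i) * a * ((5 + 2 * i) * a)
  poly = solve-∀
  nine : ∀ b → 3 * b * (3 * b) ≡ 3 * (3 * (b * b))
  nine = solve-∀

-- The base is the `L` of `iterate-differences` for `length F = 1` and `r = suc i`.
threshold : ℕ → ℕ
threshold i = (6 * (2 + i) + 4) ^ (2 ^ suc i)

large⇒sumset : ∀ i n s → threshold i ≤ n → 4 ^ (2 ^ suc i) * n ^ (2 ^ suc i ∸ 1) ≤ suc s ^ (2 ^ suc i) →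
  (A : SetIn n) → n + s ≤ ∣ A ∣ → HasSumsetPos (3 + i) n A
large⇒sumset i n s N≤n bound A n+s≤∣A∣ =
  -- The starting list holds only c₁ = 0, so every even element is a base. Here `T = suc s`,
  -- although only `s` even elements are guaranteed.
  let G , lenG , uG , x , pG = iterate-differences (suc i) {f = evens A} {F = 0 ∷ []} {g = evens A}
                                 {{n≢0}} {{m*n≢0 3 n {{_}} {{n≢0}}}} refl
                                 ([] ∷ []) (s≤s z≤n) bases (≤-reflexive (constant i)) ≤-refl
                                 (≤-trans N≤n (m≤m+n n _)) (s≤s s≤#) dense
  in subst (λ k → HasSumsetPos k n A) lenG (pairSums⇒sumset n A x G uG pG)
  where
  open ≤-Reasoning
  m = 2 ^ suc i
  K = 5 + 2 * i
  n≢0 : NonZero n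
  n≢0 = >-nonZero (≤-trans (m^n>0 (6 * (2 + i) + 4) m) N≤n)
  constant : ∀ i → suc (2 * (1 + suc i)) ≡ 5 + 2 * i
  constant = solve-∀
  bases : Bases (evens A) (0 ∷ []) (evens A)
  bases = record
    { self  = λ _ p → p
    ; sums  = λ x p → subst (T ∘ evens A) (sym (+-identityʳ x)) p ∷ []
    ; pairs = λ _ _ → [] ∷ []
    }
  s≤# : s ≤ # n (evens A)
  s≤# = +-cancelˡ-≤ n _ _ (≤-trans n+s≤∣A∣ (∣∣≤n+#evens n A))
  n*n^[m-1] : n * n ^ (m ∸ 1) ≡ n ^ m
  n*n^[m-1] = cong (n ^_) (m+[n∸m]≡n (m^n>0 2 (suc i)))
  rearrange : ∀ a n b → 3 * a * (n * b) ≡ 3 * n * (a * b)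
  rearrange = solve-∀
  dense : K * (3 * n) ^ m ≤ 3 * n * suc s ^ m
  dense = begin
    K * (3 * n) ^ m                     ≡⟨ cong (K *_) (^-distribʳ-* 3 n m) ⟩
    K * (3 ^ m * n ^ m)                 ≡⟨ *-assoc K (3 ^ m) (n ^ m) ⟨
    K * 3 ^ m * n ^ m                   ≤⟨ *-monoˡ-≤ (n ^ m) ([5+2i]3^m≤3*4^m i) ⟩
    3 * 4 ^ m * n ^ m                   ≡⟨ cong (3 * 4 ^ m *_) n*n^[m-1] ⟨
    3 * 4 ^ m * (n * n ^ (m ∸ 1))       ≡⟨ rearrange (4 ^ m) n (n ^ (m ∸ 1)) ⟩
    3 * n * (4 ^ m * n ^ (m ∸ 1))       ≤⟨ *-monoʳ-≤ (3 * n) bound ⟩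
    3 * n * suc s ^ m                   ∎

-- Deciding the existence of summands by finite search

-- The search runs over the head in `xs` and recurses on the tail. Tuples are functions, and
-- splitting one into head and tail preserves it only pointwise, hence `resp`.
∃-tuple? : ∀ {A : Set} (xs : List A) k {R : (Fin k → A) → Set} →
  (∀ {b c} → b ≗ c → R b → R c) → (∀ {b} → R b → ∀ i → b i ∈ xs) → (∀ b → Dec (R b)) → Dec (∃ R)
∃-tuple? xs zero    resp inside R? = map′ (Vector.[] ,_) (λ (b , r) → resp (λ ()) r) (R? Vector.[])
∃-tuple? xs (suc k) {R} resp inside R? = map′ to from (any? first? xs)
  where
  First : _ → Set
  First a = ∃ λ b → R (a Vector.∷ b)
  first? : ∀ a → Dec (First a)
  first? a = ∃-tuple? xs k
    (λ b≗c → resp λ { zero → refl ; (suc i) → b≗c i })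
    (λ r i → inside r (suc i))
    (λ b → R? (a Vector.∷ b))
  to : Any First xs → ∃ R
  to any = let a , _ , b , r = find any in a Vector.∷ b , r
  from : ∃ R → Any First xs
  from (b , r) = lose (inside r zero) (Vector.tail b , resp (λ { zero → refl ; (suc i) → refl }) r)

interval : ℕ → List ℤ
interval B = map +_ (upTo (suc B)) ++ map (-_ ∘ +_) (upTo (suc B))

∈-interval : ∀ {B} i → ℤ.∣ i ∣ ≤ B → i ∈ interval B
∈-interval     (+ n)    n≤B = ∈-++⁺ˡ (∈-map⁺ +_ (∈-upTo⁺ (s≤s n≤B)))
∈-interval {B} -[1+ n ] n<B = ∈-++⁺ʳ (map +_ (upTo (suc B))) (∈-map⁺ (-_ ∘ +_) (∈-upTo⁺ (s≤s n<B)))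

InA? : ∀ n x A → Dec (InA n x A)
InA? n x A = Finₚ.any? λ i → (i ∈? A) ×-dec (x ℤ.≟ + suc (toℕ i))

PairSumsIn? : ∀ n k b A → Dec (PairSumsIn n k b A)
PairSumsIn? n k b A = Finₚ.all? λ i → Finₚ.all? λ j → ¬? (i Fin.≟ j) →-dec InA? n (b i ℤ.+ b j) A

PairSumsIn-resp : ∀ n {k} A {b c : Fin k → ℤ} → b ≗ c → PairSumsIn n k b A → PairSumsIn n k c A
PairSumsIn-resp n A b≗c sums i j i≢j = subst (λ x → InA n x A) (cong₂ ℤ._+_ (b≗c i) (b≗c j)) (sums i j i≢j)

injective? : ∀ {k} (b : Fin k → ℤ) → Dec (Injective _≡_ _≡_ b)
injective? b = map′ (λ inj {i} {j} → inj i j) (λ inj i j → inj)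
  (Finₚ.all? λ i → Finₚ.all? λ j → (b i ℤ.≟ b j) →-dec (i Fin.≟ j))

injective-resp : ∀ {k} {b c : Fin k → ℤ} → b ≗ c → Injective _≡_ _≡_ b → Injective _≡_ _≡_ c
injective-resp b≗c inj {i} {j} ci≡cj = inj (trans (b≗c i) (trans ci≡cj (sym (b≗c j))))

∣InA∣≤2n : ∀ {n x A} → InA n x A → ℤ.∣ x ∣ ≤ 2 * n
∣InA∣≤2n (i , _ , refl) = Finₚ.toℕ<n i

-- Here k ≥ 3 makes the search finite: each index has the two partners needed to bound its summand.
two-others : ∀ {k} (i : Fin (3 + k)) → ∃ λ j → ∃ λ l → i ≢ j × i ≢ l × j ≢ l
two-others zero          = suc zero , suc (suc zero) , (λ ()) , (λ ()) , (λ ())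
two-others (suc zero)    = zero , suc (suc zero) , (λ ()) , (λ ()) , (λ ())
two-others (suc (suc i)) = zero , suc zero , (λ ()) , (λ ()) , (λ ())

∣i∣≤∣i+i∣ : ∀ i → ℤ.∣ i ∣ ≤ ℤ.∣ i ℤ.+ i ∣
∣i∣≤∣i+i∣ (+ n)    = m≤m+n n n
∣i∣≤∣i+i∣ -[1+ n ] = s≤s (m≤n⇒m≤1+n (m≤m+n n n))

-- Three pairwise sums determine their summands: 2 bᵢ = (bᵢ + bⱼ) + (bᵢ + bₗ) - (bⱼ + bₗ).
PairSumsIn-bounded : ∀ n {k} b A → PairSumsIn n (3 + k) b A → ∀ i → ℤ.∣ b i ∣ ≤ 2 * n + 2 * n + 2 * n
PairSumsIn-bounded n b A sums i with two-others i
... | j , l , i≢j , i≢l , j≢l = begin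
  ℤ.∣ b i ∣                                                   ≤⟨ ∣i∣≤∣i+i∣ (b i) ⟩
  ℤ.∣ b i ℤ.+ b i ∣                                           ≡⟨ cong ℤ.∣_∣ (twice (b i) (b j) (b l)) ⟩
  ℤ.∣ b i ℤ.+ b j ℤ.+ (b i ℤ.+ b l) ℤ.- (b j ℤ.+ b l) ∣       ≤⟨ ℤₚ.∣i-j∣≤∣i∣+∣j∣ (b i ℤ.+ b j ℤ.+ (b i ℤ.+ b l)) (b j ℤ.+ b l) ⟩
  ℤ.∣ b i ℤ.+ b j ℤ.+ (b i ℤ.+ b l) ∣ + ℤ.∣ b j ℤ.+ b l ∣     ≤⟨ +-monoˡ-≤ _ (ℤₚ.∣i+j∣≤∣i∣+∣j∣ (b i ℤ.+ b j) (b i ℤ.+ b l)) ⟩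
  ℤ.∣ b i ℤ.+ b j ∣ + ℤ.∣ b i ℤ.+ b l ∣ + ℤ.∣ b j ℤ.+ b l ∣   ≤⟨ +-mono-≤ (+-mono-≤ (bound i≢j) (bound i≢l)) (bound j≢l) ⟩
  2 * n + 2 * n + 2 * n                                       ∎
  where
  open ≤-Reasoning
  bound : ∀ {i j} → i ≢ j → ℤ.∣ b i ℤ.+ b j ∣ ≤ 2 * n
  bound {i} {j} i≢j = ∣InA∣≤2n {n} {b i ℤ.+ b j} {A} (sums i j i≢j)
  twice : ∀ x y z → x ℤ.+ x ≡ x ℤ.+ y ℤ.+ (x ℤ.+ z) ℤ.- (y ℤ.+ z)
  twice = ℤ-Solver.solve-∀

HasSumsetZ? : ∀ k n A → Dec (HasSumsetZ (3 + k) n A)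
HasSumsetZ? k n A = ∃-tuple? (interval _) (3 + k)
  (λ b≗c (inj , sums) → injective-resp b≗c inj , PairSumsIn-resp n A b≗c sums)
  (λ {b} (_ , sums) i → ∈-interval (b i) (PairSumsIn-bounded n b A sums i))
  (λ b → injective? b ×-dec PairSumsIn? n (3 + k) b A)

HasSumsetPos? : ∀ k n A → Dec (HasSumsetPos (3 + k) n A)
HasSumsetPos? k n A = ∃-tuple? (interval _) (3 + k)
  (λ b≗c (inj , pos , sums) → injective-resp b≗c inj , (λ i → subst (+ 0 ℤ.<_) (b≗c i) (pos i)) , PairSumsIn-resp n A b≗c sums)
  (λ {b} (_ , _ , sums) i → ∈-interval (b i) (PairSumsIn-bounded n b A sums i))
  (λ b → injective? b ×-dec Finₚ.all? (λ i → + 0 ℤ.<? b i) ×-dec PairSumsIn? n (3 + k) b A)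

HasSumsetPos⇒Z : ∀ {k} n A → HasSumsetPos k n A → HasSumsetZ k n A
HasSumsetPos⇒Z n A (b , inj , _ , sums) = b , inj , sums

¬HasSumsetZ-⊥ : ∀ k n → ¬ HasSumsetZ (3 + k) n ⊥
¬HasSumsetZ-⊥ k n (b , _ , sums) = ∉⊥ (proj₁ (proj₂ (sums zero (suc zero) λ ())))

-- Least admissible values and the conclusion

-- The search descends from `z + i`. Once `Q` fails one step below, monotonicity excludes every
-- smaller value.
∃-least : ∀ {Q : ℤ → Set} → (∀ t → Dec (Q t)) → (∀ {s t} → s ℤ.≤ t → Q s → Q t) →
  ∀ z i → ¬ Q z → Q (z ℤ.+ + i) → ∃ (IsLeast Q)
∃-least {Q} Q? mono z zero    ¬Qz q = contradiction (subst Q (ℤₚ.+-identityʳ z) q) ¬Qz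
∃-least {Q} Q? mono z (suc i) ¬Qz q with Q? (z ℤ.+ + i)
... | yes q′ = ∃-least {Q} Q? mono z i ¬Qz q′
... | no  ¬q = z ℤ.+ + suc i , q , λ s qs → ℤₚ.≮⇒≥ λ s<t → ¬q (mono (s≤pred s<t) qs)
  where
  s≤pred : ∀ {s} → s ℤ.< z ℤ.+ + suc i → s ℤ.≤ z ℤ.+ + i
  s≤pred {s} s<t = subst (s ℤ.≤_) (sym (ℤₚ.+-pred z (+ suc i))) (ℤₚ.i<j⇒i≤pred[j] s<t)

module _ {n} {P : SetIn n → Set} (P? : ∀ A → Dec (P A)) where

  Admissible? : ∀ t → Dec (Admissible n P t)
  Admissible? t with anySubset? (λ A → ¬? ((+ n ℤ.+ t ℤ.≤? + ∣ A ∣) →-dec P? A))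
  ... | yes (A , ¬P) = no λ adm → ¬P (adm A)
  ... | no  ∄A       = yes λ A → decidable-stable ((+ n ℤ.+ t ℤ.≤? + ∣ A ∣) →-dec P? A) λ ¬P → ∄A (A , ¬P)

  Admissible-mono : ∀ {s t} → s ℤ.≤ t → Admissible n P s → Admissible n P t
  Admissible-mono s≤t adm A t≤ = adm A (ℤₚ.≤-trans (ℤₚ.+-monoʳ-≤ (+ n) s≤t) t≤)

  ∃-least-admissible : ¬ P ⊥ → ∃ (IsLeast (Admissible n P))
  -- At `- n` the size condition is met even by the empty set, which fails `P`. At
  -- `- n + (2n + 1) = n + 1` it demands more than `2n` elements, so admissibility is vacuous.
  ∃-least-admissible ¬P⊥ = ∃-least {Admissible n P} Admissible? Admissible-mono (ℤ.- + n) (suc (2 * n))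
    (λ adm → ¬P⊥ (adm ⊥ (subst (ℤ._≤ + ∣ ⊥ {2 * n} ∣) (sym (ℤₚ.+-inverseʳ (+ n))) (+≤+ z≤n))))
    (λ A le → contradiction (ℤₚ.drop‿+≤+ (subst (ℤ._≤ + ∣ A ∣) (cancel (+ n) (+ suc (2 * n))) le)) (<⇒≱ (s≤s (∣p∣≤n A))))
    where
    cancel : ∀ x y → x ℤ.+ (ℤ.- x ℤ.+ y) ≡ y
    cancel = ℤ-Solver.solve-∀

-- If the bound failed at `h = suc s`, then `large⇒sumset` would make `s` admissible, against
-- minimality.
least⇒below-bound : ∀ i n → threshold i ≤ n → ∀ {h} →
  (∀ s → Admissible n (HasSumsetPos (3 + i) n) s → h ℤ.≤ s) → BelowBound h n (2 ^ suc i)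
least⇒below-bound i n n≥N { -[1+ s ]} h-least = inj₁ ℤ.-≤+
least⇒below-bound i n n≥N {+ zero}    h-least = inj₁ (+≤+ z≤n)
least⇒below-bound i n n≥N {+ suc s}   h-least
  with suc s ^ (2 ^ suc i) <? 4 ^ (2 ^ suc i) * n ^ (2 ^ suc i ∸ 1)
... | yes below = inj₂ (suc s , refl , below)
... | no  ¬below = contradiction
  (ℤₚ.drop‿+≤+ (h-least (+ s) λ A A-large → large⇒sumset i n s n≥N (≮⇒≥ ¬below) A (ℤₚ.drop‿+≤+ A-large)))
  1+n≰n

theorem10 : (k : ℕ) → k ≥ 3 → Σ ℕ λ N → (n : ℕ) → n ≥ N →
    Σ ℤ λ g → Σ ℤ λ h →
    Is-g k n g × Is-h k n h × g ℤ.≤ h × BelowBound h n (2 ^ (k ∸ 2))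
theorem10 (suc (suc (suc i))) (s≤s (s≤s (s≤s z≤n))) = threshold i , λ n n≥N →
  let g , g-admissible , g-least = ∃-least-admissible (HasSumsetZ? i n) (¬HasSumsetZ-⊥ i n)
      h , h-admissible , h-least = ∃-least-admissible (HasSumsetPos? i n) (¬HasSumsetZ-⊥ i n ∘ HasSumsetPos⇒Z n ⊥)
  in g , h , (g-admissible , g-least) , (h-admissible , h-least)
   , g-least h (λ A A-large → HasSumsetPos⇒Z n A (h-admissible A A-large))
   , least⇒below-bound i n n≥N h-least
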